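{- Computability is stable over the structure $\langle\mathbb{Q},+,-,\times,/\rangle$ of the rational numbers with addition, subtraction, multiplication and division.
   Context: Computability over natural numbers is the usual one. A set $A \subseteq \mathbb{N}$ is effectively enumerable if it is empty or the image of a total computable function from $\mathbb{N}$ to $\mathbb{N}$. For $A \subseteq \mathbb{N}^m$ and $B \subseteq \mathbb{N}$, a computable function from $A$ to $B$ is a partial computable function that is defined at every element of $A$ and takes values in $B$ there. Indexing: an indexing of a set $E$ is a partial function $i$ from $\mathbb{N}$ to $E$ such that $dom(i)$ is effectively enumerable, $i$ is surjective, and there is a computable function $eq$ from $dom(i)\times dom(i)$ to $\{0,1\}$ with $eq(x,y)=1$ if $i(x)=i(y)$ and $eq(x,y)=0$ otherwise. An indexing $i$ of the set $E$ is an admissible indexing of a one-sorted structure $\langle E,op_1,\ldots,op_p\rangle$ if every operation $op: E^m\to E$ among $op_1,\ldots,op_p$ is computable relatively to $i$, that is, there is a computable function $\hat{op}$ from $dom(i)^m$ to $dom(i)$ such that $i(\hat{op}(x_1,\ldots,x_m)) = op(i(x_1),\ldots,i(x_m))$ for all $x_1,\ldots,x_m\in dom(i)$. Division $a/b$ is a partial operation, defined for $b\neq 0$; for it, the condition is required only for arguments $x_1,x_2$ with $i(x_2)\neq 0$. Computability is stable over $\langle E,op_1,\ldots,op_p\rangle$ if there exists an admissible indexing of this structure and, for all admissible indexings $j$ and $j'$ of it, there exists a computable function $h$ from $dom(j')$ to $dom(j)$ such that $j' = j\circ h$. -}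

module Defs where

open import Data.Fin.Base using (Fin)
open import Data.List.Base using (List; []; _∷_)
open import Data.List.Relation.Unary.All using () renaming (All to AllList)
open import Data.Nat.Base using (ℕ; zero; suc; _<_)
open import Data.Nat.Properties using (<-cmp)
open import Data.Product.Base using (Σ-syntax; ∃; ∃-syntax; _×_; _,_; proj₁; proj₂)
open import Data.Rational.Base using (ℚ; 0ℚ; _+_; _-_; _*_; _÷_; ≢-nonZero)
open import Data.Sum.Base using (_⊎_)
open import Data.Vec.Base using (Vec; []; _∷_; lookup)
open import Data.Vec.Relation.Binary.Pointwise.Inductive using (Pointwise; []; _∷_)
open import Data.Vec.Relation.Unary.All using (All; []; _∷_; reduce)
open import Function.Bundles using (_⇔_)
open import Level using (0ℓ)
open import Relation.Binary.Definitions using (tri<; tri≈; tri>)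
open import Relation.Binary.PropositionalEquality using (_≡_; _≢_; refl; cong₂)
open import Relation.Unary using (Pred; _∈_; Empty; U)

-- Kleene's partial recursive functions.  In `prec f g` the recursion
-- argument comes first: h(0,xs) = f(xs), h(n+1,xs) = g(n,h(n,xs),xs).
-- `mu f` maps xs to the least y with f(y,xs) = 0.

data Code : ℕ → Set where
  zer  : ∀ {n} → Code n
  succ : Code 1
  proj : ∀ {n} → Fin n → Code n
  comp : ∀ {m n} → Code m → Vec (Code n) m → Code n
  prec : ∀ {n} → Code n → Code (suc (suc n)) → Code (suc n)
  mu   : ∀ {n} → Code (suc n) → Code n

infix 4 _⟨_⟩⇓_

-- `c ⟨ xs ⟩⇓ y`: the partial function computed by c is defined at xs, with value y.

data _⟨_⟩⇓_ : ∀ {n} → Code n → Vec ℕ n → ℕ → Set where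
  ⇓zer   : ∀ {n} {xs : Vec ℕ n} → zer ⟨ xs ⟩⇓ 0
  ⇓succ  : ∀ {x} → succ ⟨ x ∷ [] ⟩⇓ suc x
  ⇓proj  : ∀ {n} {xs : Vec ℕ n} (k : Fin n) → proj k ⟨ xs ⟩⇓ lookup xs k
  ⇓comp  : ∀ {m n} {f : Code m} {gs : Vec (Code n) m} {xs : Vec ℕ n} {ys : Vec ℕ m} {z} →
           Pointwise (λ g y → g ⟨ xs ⟩⇓ y) gs ys → f ⟨ ys ⟩⇓ z →
           comp f gs ⟨ xs ⟩⇓ z
  ⇓prec0 : ∀ {n} {f : Code n} {g} {xs : Vec ℕ n} {y} →
           f ⟨ xs ⟩⇓ y → prec f g ⟨ zero ∷ xs ⟩⇓ y
  ⇓precS : ∀ {n} {f : Code n} {g} {xs : Vec ℕ n} {k y z} →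
           prec f g ⟨ k ∷ xs ⟩⇓ y → g ⟨ k ∷ y ∷ xs ⟩⇓ z →
           prec f g ⟨ suc k ∷ xs ⟩⇓ z
  ⇓mu    : ∀ {n} {f : Code (suc n)} {xs : Vec ℕ n} {y} →
           f ⟨ y ∷ xs ⟩⇓ 0 →
           (∀ z → z < y → ∃[ k ] f ⟨ z ∷ xs ⟩⇓ suc k) →
           mu f ⟨ xs ⟩⇓ y

mutual
  ⇓-functional : ∀ {n} {c : Code n} {xs y z} → c ⟨ xs ⟩⇓ y → c ⟨ xs ⟩⇓ z → y ≡ z
  ⇓-functional ⇓zer         ⇓zer           = refl
  ⇓-functional ⇓succ        ⇓succ          = refl
  ⇓-functional (⇓proj k)    (⇓proj .k)     = refl
  ⇓-functional (⇓comp ps p) (⇓comp qs q)   with ⇓*-functional ps qs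
  ... | refl = ⇓-functional p q
  ⇓-functional (⇓prec0 p)   (⇓prec0 q)     = ⇓-functional p q
  ⇓-functional (⇓precS p r) (⇓precS q s)   with ⇓-functional p q
  ... | refl = ⇓-functional r s
  ⇓-functional (⇓mu {y = y} p below) (⇓mu {y = z} q below′) with <-cmp y z
  ... | tri≈ _ y≡z _ = y≡z
  ... | tri< y<z _ _ with below′ y y<z
  ...   | _ , r with ⇓-functional p r
  ...     | ()
  ⇓-functional (⇓mu {y = y} p below) (⇓mu {y = z} q below′) | tri> _ _ z<y with below z z<y
  ...   | _ , r with ⇓-functional r q
  ...     | ()

  ⇓*-functional : ∀ {m n} {gs : Vec (Code n) m} {xs} {ys zs : Vec ℕ m} →
                  Pointwise (λ g y → g ⟨ xs ⟩⇓ y) gs ys →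
                  Pointwise (λ g y → g ⟨ xs ⟩⇓ y) gs zs → ys ≡ zs
  ⇓*-functional []       []       = refl
  ⇓*-functional (p ∷ ps) (q ∷ qs) = cong₂ _∷_ (⇓-functional p q) (⇓*-functional ps qs)

-- A computable function from A ⊆ ℕᵐ to B ⊆ ℕ; nothing is required of the
-- underlying partial computable function outside A.

record ComputableFunction {m} (A : Pred (Vec ℕ m) 0ℓ) (B : Pred ℕ 0ℓ) : Set where
  field
    code    : Code m
    defined : ∀ xs → xs ∈ A → ∃[ y ] (code ⟨ xs ⟩⇓ y × y ∈ B)

  value : ∀ xs → xs ∈ A → ℕ
  value xs xs∈A = proj₁ (defined xs xs∈A)

  value∈ : ∀ xs (xs∈A : xs ∈ A) → value xs xs∈A ∈ B
  value∈ xs xs∈A = proj₂ (proj₂ (defined xs xs∈A))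

open ComputableFunction public

EffectivelyEnumerable : Pred ℕ 0ℓ → Set
EffectivelyEnumerable A =
  Empty A ⊎
  Σ[ f ∈ ComputableFunction {1} U U ] (∀ y → (y ∈ A) ⇔ (∃[ x ] code f ⟨ x ∷ [] ⟩⇓ y))

infix 3 _⇀_

record _⇀_ (A B : Set) : Set₁ where
  field
    dom        : Pred A 0ℓ
    at         : ∀ x → x ∈ dom → B
    -- the value depends on the argument only, not on the proof that it is in the domain
    irrelevant : ∀ x (p q : x ∈ dom) → at x p ≡ at x q

open _⇀_ public

total : ∀ {A B} → (A → B) → A ⇀ B
total f = record { dom = U ; at = λ x _ → f x ; irrelevant = λ _ _ _ → refl }

ats : ∀ {A B} (f : A ⇀ B) {m} {xs : Vec A m} → All (dom f) xs → Vec B m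
ats f = reduce (λ {x} → at f x)

Bit : Pred ℕ 0ℓ
Bit y = y ≡ 0 ⊎ y ≡ 1

record Indexing (E : Set) : Set₁ where
  field
    ix         : ℕ ⇀ E
    dom-ee     : EffectivelyEnumerable (dom ix)
    surjective : ∀ e → ∃[ x ] Σ[ p ∈ x ∈ dom ix ] at ix x p ≡ e
    eq         : ComputableFunction {2} (All (dom ix)) Bit
    eq-1       : ∀ x y (p : x ∈ dom ix) (q : y ∈ dom ix) → at ix x p ≡ at ix y q →
                 value eq (x ∷ y ∷ []) (p ∷ q ∷ []) ≡ 1
    eq-0       : ∀ x y (p : x ∈ dom ix) (q : y ∈ dom ix) → at ix x p ≢ at ix y q →
                 value eq (x ∷ y ∷ []) (p ∷ q ∷ []) ≡ 0

open Indexing public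

-- Operations may be partial (division); total ones have domain U.

record Structure : Set₁ where
  field
    Carrier    : Set
    operations : List (∃[ m ] (Vec Carrier m ⇀ Carrier))

open Structure public

-- The computable counterpart maps all of dom(i)ᵐ to dom(i); the equation is
-- required only at the arguments where op is defined.

ComputableRelativelyTo : ∀ {E} → Indexing E → ∃[ m ] (Vec E m ⇀ E) → Set
ComputableRelativelyTo i (m , op) =
  Σ[ ôp ∈ ComputableFunction {m} (All (dom (ix i))) (dom (ix i)) ]
    (∀ xs (ps : All (dom (ix i)) xs) (d : ats (ix i) ps ∈ dom op) →
      at (ix i) (value ôp xs ps) (value∈ ôp xs ps) ≡ at op (ats (ix i) ps) d)

Admissible : (S : Structure) → Indexing (Carrier S) → Set₁
Admissible S i = AllList (ComputableRelativelyTo i) (operations S)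

-- `ReducesTo j′ j`: j′ = j ∘ h for some computable h from dom(j′) to dom(j).

ReducesTo : ∀ {E} → Indexing E → Indexing E → Set
ReducesTo j′ j =
  Σ[ h ∈ ComputableFunction {1} (All (dom (ix j′))) (dom (ix j)) ]
    (∀ x (p : x ∈ dom (ix j′)) →
      at (ix j′) x p ≡ at (ix j) (value h (x ∷ []) (p ∷ [])) (value∈ h (x ∷ []) (p ∷ [])))

ComputabilityStableOver : Structure → Set₁
ComputabilityStableOver S =
  (Σ[ i ∈ Indexing (Carrier S) ] Admissible S i) ×
  (∀ (j j′ : Indexing (Carrier S)) → Admissible S j → Admissible S j′ → ReducesTo j′ j)

uncurry₂ : ∀ {A B : Set} → (A → A → B) → Vec A 2 → B
uncurry₂ f (a ∷ b ∷ []) = f a b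

DivisorNonZero : Pred (Vec ℚ 2) 0ℓ
DivisorNonZero (a ∷ b ∷ []) = b ≢ 0ℚ

divide : ∀ v → v ∈ DivisorNonZero → ℚ
divide (a ∷ b ∷ []) b≢0 = _÷_ a b {{≢-nonZero b≢0}}

division : Vec ℚ 2 ⇀ ℚ
division = record
  { dom        = DivisorNonZero
  ; at         = divide
  ; irrelevant = λ { (a ∷ b ∷ []) _ _ → refl }
  }

ℚ-field : Structure
ℚ-field = record
  { Carrier    = ℚ
  ; operations = (2 , total (uncurry₂ _+_))
               ∷ (2 , total (uncurry₂ _-_))
               ∷ (2 , total (uncurry₂ _*_))
               ∷ (2 , division)
               ∷ []
  }

{-# OPTIONS --safe #-}

-- Every rational is (a − b)/(c + 1) for some natural numbers a, b, c; coding
-- the triple by one number t gives a surjection F : ℕ → ℚ.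
-- F itself is an admissible indexing, because the field operations and
-- equality of fractions are arithmetic on a, b, c.
-- Conversely, in any admissible indexing j an index of F t can be computed
-- from t with the operations of j, starting from fixed indices of 0 and 1.
-- An index x of j′ is translated to j by searching for the first t such
-- that eq′ identifies x with the j′-index of F t, and then taking the
-- j-index of F t.

module Submission where

open import Defs
open import Data.Fin.Base using (Fin)
open import Data.Fin.Patterns using (0F; 1F; 2F)
open import Algebra.Properties.Group using (∙-cancelʳ)
open import Data.Integer.Base using (+_; -[1+_])
import Data.Integer.Base as ℤ
import Data.Integer.Properties as ℤ
open import Data.List.Relation.Unary.All using ([]; _∷_; head; tail)
open import Data.Nat.Base using (ℕ; zero; suc; pred; _<_; _≤_)
import Data.Nat.Base as ℕ
open import Data.Nat.Coprimality using (Coprime; 1-coprimeTo) renaming (sym to coprime-sym)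
import Data.Nat.Properties as ℕ
open import Data.Product.Base using (Σ-syntax; ∃-syntax; _×_; _,_; proj₁; proj₂)
open import Data.Rational.Base using (ℚ; mkℚ; 0ℚ; 1ℚ; _+_; _-_; _*_; -_; _÷_; 1/_; NonZero; ≢-nonZero)
open import Data.Rational.Properties using (_≟_; *-assoc; *-identityʳ; *-inverseˡ; *-inverseʳ; *-zeroˡ; +-comm; +-identityʳ; +-inverseʳ; +-0-group; toℚᵘ-homo-+; toℚᵘ-homo-*; toℚᵘ-injective)
open import Data.Rational.Solver using (module +-*-Solver)
open import Data.Rational.Unnormalised.Base using (*≡*)
import Data.Rational.Unnormalised.Properties as ℚᵘ
open import Data.Sum.Base using (_⊎_; inj₁; inj₂)
open import Data.Unit.Base using (tt)
open import Data.Vec.Base using (Vec; []; _∷_; lookup)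
open import Data.Vec.Relation.Binary.Pointwise.Inductive using ([]; _∷_)
open import Data.Vec.Relation.Unary.All using (All; []; _∷_)
open import Function.Base using (_∘_)
open import Function.Bundles using (mk⇔)
open import Relation.Binary.Definitions using (tri<; tri≈; tri>)
open import Relation.Binary.PropositionalEquality using (_≡_; _≢_; refl; sym; trans; cong; cong₂; subst; module ≡-Reasoning)
open import Relation.Nullary using (contradiction)
open import Relation.Nullary.Decidable using (decidable-stable)
open import Relation.Unary using (_∈_)

-- Total recursive functions

IsLeastZero : (ℕ → ℕ) → ℕ → Set
IsLeastZero f y = f y ≡ 0 × (∀ z → z < y → ∃[ k ] f z ≡ suc k)

-- Induction on the bound `n`. The failing case keeps exactly the positivity data that `⇓mu` demands
-- below its result.
least-zero-below : ∀ f n → (∃[ y ] IsLeastZero f y) ⊎ (∀ z → z < n → ∃[ k ] f z ≡ suc k)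
least-zero-below f zero    = inj₂ λ _ ()
least-zero-below f (suc n) with least-zero-below f n
... | inj₁ found = inj₁ found
... | inj₂ below with f n in fn≡
...   | zero  = inj₁ (n , fn≡ , below)
...   | suc k = inj₂ λ z z<1+n → extend (ℕ.m<1+n⇒m<n∨m≡n z<1+n)
  where
  extend : ∀ {z} → z < n ⊎ z ≡ n → ∃[ k ] f z ≡ suc k
  extend (inj₁ z<n)  = below _ z<n
  extend (inj₂ refl) = k , fn≡

-- A known zero `w` bounds the search: below `suc w` it cannot fail, so the least zero is found
-- constructively.
least-zero : ∀ f {w} → f w ≡ 0 → ∃[ y ] IsLeastZero f y
least-zero f {w} fw≡0 with least-zero-below f (suc w)
... | inj₁ found = found
... | inj₂ below with below w ℕ.≤-refl
...   | _ , fw≡suc with trans (sym fw≡0) fw≡suc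
...     | ()

-- The parameters `xs` are fixed, so `c` has to be total in the searched argument only. This matters
-- for programs that are defined just when `xs` lies in the domain of an indexing.
⇓mu-least : ∀ {n} {c : Code (suc n)} {xs f y} →
            (∀ z → c ⟨ z ∷ xs ⟩⇓ f z) → IsLeastZero f y → mu c ⟨ xs ⟩⇓ y
⇓mu-least {c = c} {xs} ⇓f (fy≡0 , below) =
  ⇓mu (subst (c ⟨ _ ∷ xs ⟩⇓_) fy≡0 (⇓f _))
      (λ z z<y → let k , fz≡ = below z z<y in k , subst (c ⟨ z ∷ xs ⟩⇓_) fz≡ (⇓f z))

-- For an expression built from the combinators below, `fun` unfolds definitionally to the
-- corresponding arithmetic expression, so facts about natural numbers apply to it directly.
record Total (n : ℕ) : Set where
  field
    program  : Code n
    fun      : Vec ℕ n → ℕ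
    computes : ∀ xs → program ⟨ xs ⟩⇓ fun xs

open Total

var : ∀ {n} → Fin n → Total n
var k = record { program = proj k ; fun = λ xs → lookup xs k ; computes = λ _ → ⇓proj k }

constCode : ∀ {n} → ℕ → Code n
constCode zero    = zer
constCode (suc k) = comp succ (constCode k ∷ [])

⇓const : ∀ {n} {xs : Vec ℕ n} k → constCode k ⟨ xs ⟩⇓ k
⇓const zero    = ⇓zer
⇓const (suc k) = ⇓comp (⇓const k ∷ []) ⇓succ

const : ∀ {n} → ℕ → Total n
const k = record { program = constCode k ; fun = λ _ → k ; computes = λ _ → ⇓const k }

apply₁ : ∀ {n} {f : ℕ → ℕ} {c : Code 1} → (∀ x → c ⟨ x ∷ [] ⟩⇓ f x) → Total n → Total n
apply₁ {f = f} {c} ⇓f s = record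
  { program  = comp c (program s ∷ [])
  ; fun      = λ xs → f (fun s xs)
  ; computes = λ xs → ⇓comp (computes s xs ∷ []) (⇓f _)
  }

apply₂ : ∀ {n} {f : ℕ → ℕ → ℕ} {c : Code 2} → (∀ x y → c ⟨ x ∷ y ∷ [] ⟩⇓ f x y) →
         Total n → Total n → Total n
apply₂ {f = f} {c} ⇓f s t = record
  { program  = comp c (program s ∷ program t ∷ [])
  ; fun      = λ xs → f (fun s xs) (fun t xs)
  ; computes = λ xs → ⇓comp (computes s xs ∷ computes t xs ∷ []) (⇓f _ _)
  }

-- Programs for arithmetic

plusCode : Code 2
plusCode = prec (proj 0F) (comp succ (proj 1F ∷ []))

⇓plus : ∀ x y → plusCode ⟨ x ∷ y ∷ [] ⟩⇓ x ℕ.+ y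
⇓plus zero    y = ⇓prec0 (⇓proj 0F)
⇓plus (suc x) y = ⇓precS (⇓plus x y) (⇓comp (⇓proj 1F ∷ []) ⇓succ)

timesCode : Code 2
timesCode = prec zer (comp plusCode (proj 2F ∷ proj 1F ∷ []))

⇓times : ∀ x y → timesCode ⟨ x ∷ y ∷ [] ⟩⇓ x ℕ.* y
⇓times zero    y = ⇓prec0 ⇓zer
⇓times (suc x) y = ⇓precS (⇓times x y) (⇓comp (⇓proj 2F ∷ ⇓proj 1F ∷ []) (⇓plus y _))

predCode : Code 1
predCode = prec zer (proj 0F)

⇓pred : ∀ x → predCode ⟨ x ∷ [] ⟩⇓ pred x
⇓pred zero    = ⇓prec0 ⇓zer
⇓pred (suc x) = ⇓precS (⇓pred x) (⇓proj 0F)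

-- Recursion is on the subtrahend, which `prec` expects first.
monusCode : Code 2
monusCode = prec (proj 0F) (comp predCode (proj 1F ∷ []))

⇓monus : ∀ y x → monusCode ⟨ y ∷ x ∷ [] ⟩⇓ x ℕ.∸ y
⇓monus zero    x = ⇓prec0 (⇓proj 0F)
⇓monus (suc y) x = ⇓precS (⇓monus y x) (⇓comp (⇓proj 1F ∷ [])
  (subst (predCode ⟨ x ℕ.∸ y ∷ [] ⟩⇓_) (ℕ.pred[m∸n]≡m∸[1+n] x y) (⇓pred _)))

infixl 6 _⊕_ _⊖_
infixl 7 _⊗_

_⊕_ _⊗_ _⊖_ : ∀ {n} → Total n → Total n → Total n
_⊕_ = apply₂ ⇓plus
_⊗_ = apply₂ ⇓times
s ⊖ t = apply₂ ⇓monus t s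

-- Coding triples of natural numbers

-- This vanishes exactly when t < (s + 1)², so its least zero in `s` is the integer square root of
-- `t`.
excess : ℕ → ℕ → ℕ
excess t s = suc t ℕ.∸ suc s ℕ.* suc s

excess-self : ∀ t → excess t t ≡ 0
excess-self t = ℕ.m≤n⇒m∸n≡0 (ℕ.m≤m*n (suc t) (suc t))

-- Abstract: unfolding the search inside codes of triples makes conversion checking explode.
abstract
  sqrt-search : ∀ t → ∃[ s ] IsLeastZero (excess t) s
  sqrt-search t = least-zero (excess t) {t} (excess-self t)

⌊√_⌋ : ℕ → ℕ
⌊√ t ⌋ = proj₁ (sqrt-search t)

-- If r < s, then (r + 1)² ≤ s² ≤ t, so `r` is not a zero of the excess; if s < r, then `s` is a
-- zero smaller than the least one.
⌊√⌋-unique : ∀ t s → s ℕ.* s ≤ t → t < suc s ℕ.* suc s → ⌊√ t ⌋ ≡ s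
⌊√⌋-unique t s s²≤t t<[1+s]² with sqrt-search t
... | r , r-zero , r-least with ℕ.<-cmp r s
...   | tri≈ _ r≡s _ = r≡s
...   | tri< r<s _ _ = contradiction
          (ℕ.≤-trans (ℕ.m∸n≡0⇒m≤n r-zero) (ℕ.≤-trans (ℕ.*-mono-≤ r<s r<s) s²≤t)) (ℕ.<-irrefl refl)
...   | tri> _ _ s<r with r-least s s<r
...     | _ , s-nonzero with trans (sym (ℕ.m≤n⇒m∸n≡0 t<[1+s]²)) s-nonzero
...       | ()

-- Variable 0 is the candidate root, because `mu` puts the searched argument first.
excessT : Total 2
excessT = (const 1 ⊕ var 1F) ⊖ (const 1 ⊕ var 0F) ⊗ (const 1 ⊕ var 0F)

⇓sqrt : ∀ t → mu (program excessT) ⟨ t ∷ [] ⟩⇓ ⌊√ t ⌋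
⇓sqrt t = ⇓mu-least (λ s → computes excessT (s ∷ t ∷ [])) (proj₂ (sqrt-search t))

-- Since x ≤ x + y, the code lies between (x + y)² and the next square. The square root thus
-- recovers x + y, and the remainder is x. The coding is not onto, but every number decodes to some
-- pair.
pair : ℕ → ℕ → ℕ
pair x y = (x ℕ.+ y) ℕ.* (x ℕ.+ y) ℕ.+ x

left right : ℕ → ℕ
left  t = t ℕ.∸ ⌊√ t ⌋ ℕ.* ⌊√ t ⌋
right t = ⌊√ t ⌋ ℕ.∸ left t

⌊√pair⌋ : ∀ x y → ⌊√ pair x y ⌋ ≡ x ℕ.+ y
⌊√pair⌋ x y = ⌊√⌋-unique (pair x y) s (ℕ.m≤m+n (s ℕ.* s) x) (ℕ.s≤s bound)
  where
  s = x ℕ.+ y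
  open ℕ.≤-Reasoning
  -- `suc s * suc s` reduces to `suc (s + s * suc s)`; the outer `s≤s` removes the successor on both
  -- sides of the strict inequality.
  bound : s ℕ.* s ℕ.+ x ≤ s ℕ.+ s ℕ.* suc s
  bound = begin
    s ℕ.* s ℕ.+ x      ≤⟨ ℕ.+-mono-≤ (ℕ.*-monoʳ-≤ s (ℕ.n≤1+n s)) (ℕ.m≤m+n x y) ⟩
    s ℕ.* suc s ℕ.+ s  ≡⟨ ℕ.+-comm (s ℕ.* suc s) s ⟩
    s ℕ.+ s ℕ.* suc s  ∎

left-pair : ∀ x y → left (pair x y) ≡ x
left-pair x y rewrite ⌊√pair⌋ x y = ℕ.m+n∸m≡n ((x ℕ.+ y) ℕ.* (x ℕ.+ y)) x

right-pair : ∀ x y → right (pair x y) ≡ y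
right-pair x y rewrite left-pair x y | ⌊√pair⌋ x y = ℕ.m+n∸m≡n x y

pairT : ∀ {n} → Total n → Total n → Total n
pairT s t = (s ⊕ t) ⊗ (s ⊕ t) ⊕ s

sqrtT leftT rightT : ∀ {n} → Total n → Total n
sqrtT    = apply₁ ⇓sqrt
leftT  t = t ⊖ sqrtT t ⊗ sqrtT t
rightT t = sqrtT t ⊖ leftT t

plusPart minusPart denPart : ℕ → ℕ
plusPart  t = left t
minusPart t = left (right t)
denPart   t = right (right t)

plusPartT minusPartT denPartT : ∀ {n} → Total n → Total n
plusPartT  t = leftT t
minusPartT t = leftT (rightT t)
denPartT   t = rightT (rightT t)

triple : ℕ → ℕ → ℕ → ℕ
triple a b c = pair a (pair b c)

tripleT : ∀ {n} → Total n → Total n → Total n → Total n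
tripleT a b c = pairT a (pairT b c)

-- Rational numbers as fractions (a − b)/(c + 1)

-- Given in lowest terms by the constructor, so that injectivity is constructor injectivity.
nat : ℕ → ℚ
nat n = mkℚ (+ n) 0 (coprime-sym (1-coprimeTo n))

-- For unnormalised rationals, where no common factor is cancelled, this is an identity of integers.
nat-+ : ∀ m n → nat (m ℕ.+ n) ≡ nat m + nat n
nat-+ m n = toℚᵘ-injective (ℚᵘ.≃-trans
  (*≡* (cong (ℤ._* + 1) (sym (cong₂ ℤ._+_ (ℤ.*-identityʳ (+ m)) (ℤ.*-identityʳ (+ n))))))
  (ℚᵘ.≃-sym (toℚᵘ-homo-+ (nat m) (nat n))))

nat-* : ∀ m n → nat (m ℕ.* n) ≡ nat m * nat n
nat-* m n = toℚᵘ-injective (ℚᵘ.≃-trans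
  (*≡* (cong (ℤ._* + 1) (ℤ.pos-* m n)))
  (ℚᵘ.≃-sym (toℚᵘ-homo-* (nat m) (nat n))))

nat-injective : ∀ {m n} → nat m ≡ nat n → m ≡ n
nat-injective refl = refl

*-cancelʳ : ∀ {p q} r .{{_ : NonZero r}} → p * r ≡ q * r → p ≡ q
*-cancelʳ {p} {q} r pr≡qr = begin
  p               ≡⟨ *-identityʳ p ⟨
  p * 1ℚ          ≡⟨ cong (p *_) (*-inverseʳ r) ⟨
  p * (r * 1/ r)  ≡⟨ *-assoc p r (1/ r) ⟨
  p * r * 1/ r    ≡⟨ cong (_* 1/ r) pr≡qr ⟩
  q * r * 1/ r    ≡⟨ *-assoc q r (1/ r) ⟩
  q * (r * 1/ r)  ≡⟨ cong (q *_) (*-inverseʳ r) ⟩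
  q * 1ℚ          ≡⟨ *-identityʳ q ⟩
  q               ∎
  where open ≡-Reasoning

÷-* : ∀ p q .{{_ : NonZero q}} → p ÷ q * q ≡ p
÷-* p q = trans (*-assoc p (1/ q) q) (trans (cong (p *_) (*-inverseˡ q)) (*-identityʳ p))

frac : ℕ → ℕ → ℕ → ℚ
frac a b c = (nat a - nat b) ÷ nat (suc c)

-- The division-free form of q = (a - b)/(c + 1) leaves ring identities to prove. As a record it
-- lets `a`, `b`, `c` be inferred from the type.
record IsFrac (a b c : ℕ) (q : ℚ) : Set where
  constructor mkIsFrac
  field
    cleared : q * nat (suc c) ≡ nat a - nat b

open IsFrac

frac-isFrac : ∀ a b c → IsFrac a b c (frac a b c)
frac-isFrac a b c = mkIsFrac (÷-* (nat a - nat b) (nat (suc c)))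

isFrac⇒frac≡ : ∀ {a b c q} → IsFrac a b c q → frac a b c ≡ q
isFrac⇒frac≡ {a} {b} {c} q-frac = *-cancelʳ (nat (suc c)) (trans (cleared (frac-isFrac a b c)) (sym (cleared q-frac)))

nat-*+* : ∀ k l m n → nat (k ℕ.* l ℕ.+ m ℕ.* n) ≡ nat k * nat l + nat m * nat n
nat-*+* k l m n = trans (nat-+ (k ℕ.* l) (m ℕ.* n)) (cong₂ _+_ (nat-* k l) (nat-* m n))

-- suc (denProduct c c′) is suc c * suc c′ definitionally.
denProduct : ℕ → ℕ → ℕ
denProduct c c′ = c′ ℕ.+ c ℕ.* suc c′

isFrac-neg : ∀ {a b c p} → IsFrac a b c p → IsFrac b a c (- p)
isFrac-neg {a} {b} {c} {p} (mkIsFrac p-eq) = mkIsFrac (begin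
  - p * nat (suc c)    ≡⟨ solve 2 (λ p d → :- p :* d := :- (p :* d)) refl p (nat (suc c)) ⟩
  - (p * nat (suc c))  ≡⟨ cong -_ p-eq ⟩
  - (nat a - nat b)    ≡⟨ solve 2 (λ a b → :- (a :- b) := b :- a) refl (nat a) (nat b) ⟩
  nat b - nat a        ∎)
  where open ≡-Reasoning; open +-*-Solver

isFrac-+ : ∀ {a b c a′ b′ c′ p q} → IsFrac a b c p → IsFrac a′ b′ c′ q →
           IsFrac (a ℕ.* suc c′ ℕ.+ a′ ℕ.* suc c) (b ℕ.* suc c′ ℕ.+ b′ ℕ.* suc c)
                  (denProduct c c′) (p + q)
isFrac-+ {a} {b} {c} {a′} {b′} {c′} {p} {q} (mkIsFrac p-eq) (mkIsFrac q-eq) = mkIsFrac (begin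
  (p + q) * nat (suc c ℕ.* suc c′)
    ≡⟨ cong ((p + q) *_) (nat-* (suc c) (suc c′)) ⟩
  (p + q) * (d * d′)
    ≡⟨ solve 4 (λ p q d d′ → (p :+ q) :* (d :* d′) := p :* d :* d′ :+ q :* d′ :* d) refl p q d d′ ⟩
  p * d * d′ + q * d′ * d
    ≡⟨ cong₂ (λ x y → x * d′ + y * d) p-eq q-eq ⟩
  (nat a - nat b) * d′ + (nat a′ - nat b′) * d
    ≡⟨ solve 6 (λ a b d a′ b′ d′ → (a :- b) :* d′ :+ (a′ :- b′) :* d
                                := (a :* d′ :+ a′ :* d) :- (b :* d′ :+ b′ :* d))
             refl (nat a) (nat b) d (nat a′) (nat b′) d′ ⟩
  (nat a * d′ + nat a′ * d) - (nat b * d′ + nat b′ * d)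
    ≡⟨ cong₂ _-_ (nat-*+* a (suc c′) a′ (suc c)) (nat-*+* b (suc c′) b′ (suc c)) ⟨
  nat (a ℕ.* suc c′ ℕ.+ a′ ℕ.* suc c) - nat (b ℕ.* suc c′ ℕ.+ b′ ℕ.* suc c) ∎)
  where
  open ≡-Reasoning
  open +-*-Solver
  d = nat (suc c)
  d′ = nat (suc c′)

isFrac-* : ∀ {a b c a′ b′ c′ p q} → IsFrac a b c p → IsFrac a′ b′ c′ q →
           IsFrac (a ℕ.* a′ ℕ.+ b ℕ.* b′) (a ℕ.* b′ ℕ.+ b ℕ.* a′) (denProduct c c′) (p * q)
isFrac-* {a} {b} {c} {a′} {b′} {c′} {p} {q} (mkIsFrac p-eq) (mkIsFrac q-eq) = mkIsFrac (begin
  p * q * nat (suc c ℕ.* suc c′)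
    ≡⟨ cong (p * q *_) (nat-* (suc c) (suc c′)) ⟩
  p * q * (d * d′)
    ≡⟨ solve 4 (λ p q d d′ → p :* q :* (d :* d′) := p :* d :* (q :* d′)) refl p q d d′ ⟩
  p * d * (q * d′)
    ≡⟨ cong₂ _*_ p-eq q-eq ⟩
  (nat a - nat b) * (nat a′ - nat b′)
    ≡⟨ solve 4 (λ a b a′ b′ → (a :- b) :* (a′ :- b′) := (a :* a′ :+ b :* b′) :- (a :* b′ :+ b :* a′))
             refl (nat a) (nat b) (nat a′) (nat b′) ⟩
  (nat a * nat a′ + nat b * nat b′) - (nat a * nat b′ + nat b * nat a′)
    ≡⟨ cong₂ _-_ (nat-*+* a a′ b b′) (nat-*+* a b′ b a′) ⟨
  nat (a ℕ.* a′ ℕ.+ b ℕ.* b′) - nat (a ℕ.* b′ ℕ.+ b ℕ.* a′) ∎)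
  where
  open ≡-Reasoning
  open +-*-Solver
  d = nat (suc c)
  d′ = nat (suc c′)

-- The absolute difference |m - n|. It serves as an equality test and, squared, as a positive
-- denominator for quotients.
dist : ℕ → ℕ → ℕ
dist m n = (m ℕ.∸ n) ℕ.+ (n ℕ.∸ m)

dist≡0⇒≡ : ∀ m n → dist m n ≡ 0 → m ≡ n
dist≡0⇒≡ m n eq = ℕ.≤-antisym
  (ℕ.m∸n≡0⇒m≤n (ℕ.m+n≡0⇒m≡0 (m ℕ.∸ n) eq))
  (ℕ.m∸n≡0⇒m≤n (ℕ.m+n≡0⇒n≡0 (m ℕ.∸ n) eq))

≡⇒dist≡0 : ∀ m n → m ≡ n → dist m n ≡ 0
≡⇒dist≡0 m .m refl = cong₂ ℕ._+_ (ℕ.n∸n≡0 m) (ℕ.n∸n≡0 m)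

dist-+ : ∀ m k → dist m (m ℕ.+ k) ≡ k
dist-+ m k = cong₂ ℕ._+_ (ℕ.m≤n⇒m∸n≡0 (ℕ.m≤m+n m k)) (ℕ.m+n∸m≡n m k)

dist-comm : ∀ m n → dist m n ≡ dist n m
dist-comm m n = ℕ.+-comm (m ℕ.∸ n) (n ℕ.∸ m)

-- Squaring forgets the sign. With the larger number written as the smaller plus `k`, the distance
-- is `k` and both cases are ring identities.
nat-dist² : ∀ m n → nat (dist m n) * nat (dist m n) ≡ (nat m - nat n) * (nat m - nat n)
nat-dist² m n with ℕ.≤-total m n
... | inj₁ m≤n with ℕ.m≤n⇒∃[o]m+o≡n m≤n
...   | k , refl rewrite dist-+ m k | nat-+ m k =
  solve 2 (λ m k → k :* k := (m :- (m :+ k)) :* (m :- (m :+ k))) refl (nat m) (nat k)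
  where open +-*-Solver
nat-dist² m n | inj₂ n≤m with ℕ.m≤n⇒∃[o]m+o≡n n≤m
...   | k , refl rewrite dist-comm (n ℕ.+ k) n | dist-+ n k | nat-+ n k =
  solve 2 (λ n k → k :* k := ((n :+ k) :- n) :* ((n :+ k) :- n)) refl (nat n) (nat k)
  where open +-*-Solver

-- p ÷ q is computed as p q / q², so that the denominator is positive whatever the sign of q.
isFrac-÷ : ∀ {a b c a′ b′ c′ p q} .{{_ : NonZero q}} → q ≢ 0ℚ → IsFrac a b c p → IsFrac a′ b′ c′ q →
           IsFrac ((a ℕ.* a′ ℕ.+ b ℕ.* b′) ℕ.* suc c′) ((a ℕ.* b′ ℕ.+ b ℕ.* a′) ℕ.* suc c′)
                  (pred (dist a′ b′ ℕ.* dist a′ b′ ℕ.* suc c)) (p ÷ q)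
isFrac-÷ {a} {b} {c} {a′} {b′} {c′} {p} {q} q≢0 (mkIsFrac p-eq) (mkIsFrac q-eq) = mkIsFrac (begin
  p ÷ q * nat (suc (pred D))
    ≡⟨ cong (λ m → p ÷ q * nat m) (ℕ.suc-pred D) ⟩
  p ÷ q * nat D
    ≡⟨ cong (p ÷ q *_) (trans (nat-* (e ℕ.* e) (suc c)) (cong (_* d) (trans (nat-* e e) (nat-dist² a′ b′)))) ⟩
  p ÷ q * (y * y * d)
    -- Replacing one of the two factors `y` by `q * d′` supplies the `q` that cancels the division.
    ≡⟨ cong (λ z → p ÷ q * (z * y * d)) q-eq ⟨
  p ÷ q * (q * d′ * y * d)
    ≡⟨ solve 5 (λ r q d′ y d → r :* (q :* d′ :* y :* d) := r :* q :* d :* y :* d′) refl (p ÷ q) q d′ y d ⟩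
  p ÷ q * q * d * y * d′
    ≡⟨ cong (λ z → z * d * y * d′) (÷-* p q) ⟩
  p * d * y * d′
    ≡⟨ cong (λ z → z * y * d′) p-eq ⟩
  (nat a - nat b) * y * d′
    ≡⟨ solve 5 (λ a b a′ b′ d′ → (a :- b) :* (a′ :- b′) :* d′
                              := (a :* a′ :+ b :* b′) :* d′ :- (a :* b′ :+ b :* a′) :* d′)
             refl (nat a) (nat b) (nat a′) (nat b′) d′ ⟩
  (nat a * nat a′ + nat b * nat b′) * d′ - (nat a * nat b′ + nat b * nat a′) * d′
    ≡⟨ cong₂ _-_ (numerator a a′ b b′) (numerator a b′ b a′) ⟨
  nat ((a ℕ.* a′ ℕ.+ b ℕ.* b′) ℕ.* suc c′) - nat ((a ℕ.* b′ ℕ.+ b ℕ.* a′) ℕ.* suc c′) ∎)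
  where
  open ≡-Reasoning
  open +-*-Solver
  d = nat (suc c)
  d′ = nat (suc c′)
  y = nat a′ - nat b′
  e = dist a′ b′
  D = e ℕ.* e ℕ.* suc c

  -- A zero distance would make the numerator of `q` vanish. Hence `D` is positive, and the `pred`
  -- that offsets the + 1 in the denominator is undone exactly.
  e≢0 : e ≢ 0
  e≢0 e≡0 with dist≡0⇒≡ a′ b′ e≡0
  ... | refl = q≢0 (*-cancelʳ d′ (trans q-eq (trans (+-inverseʳ (nat a′)) (sym (*-zeroˡ d′)))))

  instance
    e-nonZero : ℕ.NonZero e
    e-nonZero = ℕ.≢-nonZero e≢0

    e²-nonZero : ℕ.NonZero (e ℕ.* e)
    e²-nonZero = ℕ.m*n≢0 e e

    D-nonZero : ℕ.NonZero D
    D-nonZero = ℕ.m*n≢0 (e ℕ.* e) (suc c)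

  numerator : ∀ k l m n → nat ((k ℕ.* l ℕ.+ m ℕ.* n) ℕ.* suc c′) ≡ (nat k * nat l + nat m * nat n) * d′
  numerator k l m n = trans (nat-* (k ℕ.* l ℕ.+ m ℕ.* n) (suc c′)) (cong (_* d′) (nat-*+* k l m n))

-- Moving the minus parts across avoids subtraction in the natural numbers. The last summand is
-- symmetric in the two fractions, so comparing cross sums amounts to comparing `p` and `q` times
-- the common denominator.
cross-sum : ∀ {a b c p} b′ c′ → IsFrac a b c p →
            nat (a ℕ.* suc c′ ℕ.+ b′ ℕ.* suc c)
              ≡ p * nat (suc c ℕ.* suc c′) + (nat b * nat (suc c′) + nat b′ * nat (suc c))
cross-sum {a} {b} {c} {p} b′ c′ (mkIsFrac p-eq) = begin
  nat (a ℕ.* suc c′ ℕ.+ b′ ℕ.* suc c)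
    ≡⟨ nat-*+* a (suc c′) b′ (suc c) ⟩
  nat a * d′ + nat b′ * d
    ≡⟨ solve 5 (λ a b b′ d d′ → a :* d′ :+ b′ :* d := (a :- b) :* d′ :+ (b :* d′ :+ b′ :* d))
             refl (nat a) (nat b) (nat b′) d d′ ⟩
  (nat a - nat b) * d′ + (nat b * d′ + nat b′ * d)
    ≡⟨ cong (λ z → z * d′ + (nat b * d′ + nat b′ * d)) p-eq ⟨
  p * d * d′ + (nat b * d′ + nat b′ * d)
    ≡⟨ cong (_+ (nat b * d′ + nat b′ * d)) (trans (*-assoc p d d′) (cong (p *_) (sym (nat-* (suc c) (suc c′))))) ⟩
  p * nat (suc c ℕ.* suc c′) + (nat b * d′ + nat b′ * d) ∎
  where
  open ≡-Reasoning
  open +-*-Solver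
  d = nat (suc c)
  d′ = nat (suc c′)

module _ {a b c a′ b′ c′ p q} (p-frac : IsFrac a b c p) (q-frac : IsFrac a′ b′ c′ q) where

  private
    D = nat (suc c ℕ.* suc c′)
    B = nat b * nat (suc c′) + nat b′ * nat (suc c)

    q-sum : nat (a′ ℕ.* suc c ℕ.+ b ℕ.* suc c′) ≡ q * D + B
    q-sum = trans (cross-sum b c q-frac) (cong₂ _+_
      (cong (λ n → q * nat n) (ℕ.*-comm (suc c′) (suc c)))
      (+-comm (nat b′ * nat (suc c)) (nat b * nat (suc c′))))

  ≡⇒cross≡ : p ≡ q → a ℕ.* suc c′ ℕ.+ b′ ℕ.* suc c ≡ a′ ℕ.* suc c ℕ.+ b ℕ.* suc c′
  ≡⇒cross≡ p≡q = nat-injective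
    (trans (cross-sum b′ c′ p-frac) (trans (cong (λ r → r * D + B) p≡q) (sym q-sum)))

  cross≡⇒≡ : a ℕ.* suc c′ ℕ.+ b′ ℕ.* suc c ≡ a′ ℕ.* suc c ℕ.+ b ℕ.* suc c′ → p ≡ q
  cross≡⇒≡ cross = *-cancelʳ D (∙-cancelʳ +-0-group B (p * D) (q * D)
    (trans (sym (cross-sum b′ c′ p-frac)) (trans (cong nat cross) q-sum)))

pos-isFrac : ∀ k c .(coprime : Coprime k (suc c)) → IsFrac k 0 c (mkℚ (+ k) c coprime)
pos-isFrac k c coprime = mkIsFrac (trans
  (toℚᵘ-injective (ℚᵘ.≃-trans (toℚᵘ-homo-* (mkℚ (+ k) c coprime) (nat (suc c)))
    (*≡* (trans (ℤ.*-identityʳ _) (cong (+ k ℤ.*_) (cong +_ (sym (ℕ.*-identityʳ (suc c)))))))))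
  (sym (+-identityʳ (nat k))))

isFrac-surjective : ∀ q → ∃[ a ] ∃[ b ] ∃[ c ] IsFrac a b c q
isFrac-surjective (mkℚ (+ k) c coprime)    = k , 0 , c , pos-isFrac k c coprime
isFrac-surjective (mkℚ -[1+ k ] c coprime) =
  -- The negation of the positive fraction reduces to the given negative one.
  0 , suc k , c , isFrac-neg (pos-isFrac (suc k) c coprime)

-- The enumeration F and its admissibility

F : ℕ → ℚ
F t = frac (plusPart t) (minusPart t) (denPart t)

F-isFrac : ∀ t → IsFrac (plusPart t) (minusPart t) (denPart t) (F t)
F-isFrac t = frac-isFrac (plusPart t) (minusPart t) (denPart t)

plusPart-triple : ∀ a b c → plusPart (triple a b c) ≡ a
plusPart-triple a b c = left-pair a (pair b c)

minusPart-triple : ∀ a b c → minusPart (triple a b c) ≡ b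
minusPart-triple a b c = trans (cong left (right-pair a (pair b c))) (left-pair b c)

denPart-triple : ∀ a b c → denPart (triple a b c) ≡ c
denPart-triple a b c = trans (cong right (right-pair a (pair b c))) (right-pair b c)

frac-cong : ∀ {a a′ b b′ c c′} → a ≡ a′ → b ≡ b′ → c ≡ c′ → frac a b c ≡ frac a′ b′ c′
frac-cong refl refl refl = refl

F-triple : ∀ {a b c q} → IsFrac a b c q → F (triple a b c) ≡ q
F-triple {a} {b} {c} q-frac = trans
  (frac-cong (plusPart-triple a b c) (minusPart-triple a b c) (denPart-triple a b c))
  (isFrac⇒frac≡ q-frac)

F-surjective : ∀ q → ∃[ t ] F t ≡ q
F-surjective q = let a , b , c , q-frac = isFrac-surjective q in triple a b c , F-triple q-frac

-- The components of the two fractions with codes `var 0F` and `var 1F`.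
a₀ b₀ c₀ d₀ a₁ b₁ c₁ d₁ : Total 2
a₀ = plusPartT (var 0F)
b₀ = minusPartT (var 0F)
c₀ = denPartT (var 0F)
d₀ = const 1 ⊕ c₀
a₁ = plusPartT (var 1F)
b₁ = minusPartT (var 1F)
c₁ = denPartT (var 1F)
d₁ = const 1 ⊕ c₁

distT : ∀ {n} → Total n → Total n → Total n
distT s t = (s ⊖ t) ⊕ (t ⊖ s)

record FracT (n : ℕ) : Set where
  field
    plusT minusT denT : Total n

open FracT

encode : ∀ {n} → FracT n → Total n
encode f = tripleT (plusT f) (minusT f) (denT f)

F-encode : ∀ {n} (f : FracT n) xs {q} →
           IsFrac (fun (plusT f) xs) (fun (minusT f) xs) (fun (denT f) xs) q → F (fun (encode f) xs) ≡ q
F-encode f xs q-frac = F-triple q-frac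

-- The components unfold to those in `isFrac-+`, `isFrac-*` and `isFrac-÷`, with `const 1 ⊕ c₀`
-- reducing to a successor. The difference is the sum with the parts of the second fraction swapped.
sumT differenceT productT quotientT : FracT 2
sumT = record
  { plusT  = a₀ ⊗ d₁ ⊕ a₁ ⊗ d₀
  ; minusT = b₀ ⊗ d₁ ⊕ b₁ ⊗ d₀
  ; denT   = c₁ ⊕ c₀ ⊗ d₁
  }
differenceT = record
  { plusT  = a₀ ⊗ d₁ ⊕ b₁ ⊗ d₀
  ; minusT = b₀ ⊗ d₁ ⊕ a₁ ⊗ d₀
  ; denT   = c₁ ⊕ c₀ ⊗ d₁
  }
productT = record
  { plusT  = a₀ ⊗ a₁ ⊕ b₀ ⊗ b₁
  ; minusT = a₀ ⊗ b₁ ⊕ b₀ ⊗ a₁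
  ; denT   = c₁ ⊕ c₀ ⊗ d₁
  }
quotientT = record
  { plusT  = (a₀ ⊗ a₁ ⊕ b₀ ⊗ b₁) ⊗ d₁
  ; minusT = (a₀ ⊗ b₁ ⊕ b₀ ⊗ a₁) ⊗ d₁
  -- For a zero divisor `pred` returns 0, so the program still yields a code.
  ; denT   = apply₁ ⇓pred (distT a₁ b₁ ⊗ distT a₁ b₁ ⊗ d₀)
  }

crossT₀ crossT₁ crossDistT : Total 2
crossT₀    = a₀ ⊗ d₁ ⊕ b₁ ⊗ d₀
crossT₁    = a₁ ⊗ d₀ ⊕ b₀ ⊗ d₁
crossDistT = distT crossT₀ crossT₁

F≡⇒crossDist≡0 : ∀ s t → F s ≡ F t → fun crossDistT (s ∷ t ∷ []) ≡ 0
F≡⇒crossDist≡0 s t Fs≡Ft = ≡⇒dist≡0 (fun crossT₀ (s ∷ t ∷ [])) (fun crossT₁ (s ∷ t ∷ []))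
  (≡⇒cross≡ (F-isFrac s) (F-isFrac t) Fs≡Ft)

crossDist≡0⇒F≡ : ∀ s t → fun crossDistT (s ∷ t ∷ []) ≡ 0 → F s ≡ F t
crossDist≡0⇒F≡ s t dist≡0 = cross≡⇒≡ (F-isFrac s) (F-isFrac t)
  (dist≡0⇒≡ (fun crossT₀ (s ∷ t ∷ [])) (fun crossT₁ (s ∷ t ∷ [])) dist≡0)

computable : ∀ {m A B} (f : Total m) → (∀ xs → fun f xs ∈ B) → ComputableFunction {m} A B
computable f f∈B = record { code = program f ; defined = λ xs _ → fun f xs , computes f xs , f∈B xs }

1∸-bit : ∀ n → Bit (1 ℕ.∸ n)
1∸-bit zero    = inj₂ refl
1∸-bit (suc n) = inj₁ (ℕ.0∸n≡0 n)

1∸-nonzero : ∀ {n} → n ≢ 0 → 1 ℕ.∸ n ≡ 0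
1∸-nonzero {zero}  n≢0 = contradiction refl n≢0
1∸-nonzero {suc n} n≢0 = ℕ.0∸n≡0 n

F-indexing : Indexing ℚ
F-indexing = record
  { ix         = total F
  ; dom-ee     = inj₂ (computable (var 0F) (λ _ → tt) , λ y → mk⇔ (λ _ → y , ⇓proj 0F) (λ _ → tt))
  ; surjective = λ q → let t , Ft≡q = F-surjective q in t , tt , Ft≡q
  ; eq         = computable (const 1 ⊖ crossDistT) (λ xs → 1∸-bit (fun crossDistT xs))
  ; eq-1       = λ s t _ _ Fs≡Ft → cong (1 ℕ.∸_) (F≡⇒crossDist≡0 s t Fs≡Ft)
  ; eq-0       = λ s t _ _ Fs≢Ft → 1∸-nonzero (Fs≢Ft ∘ crossDist≡0⇒F≡ s t)
  }

-- Each fraction is bound first: unifying it with unfolded encodings is intractable.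
F-admissible : Admissible ℚ-field F-indexing
F-admissible =
    (computable (encode sumT) (λ _ → tt) , λ { xs@(s ∷ t ∷ []) (_ ∷ _ ∷ []) _ →
      let sum-frac = isFrac-+ (F-isFrac s) (F-isFrac t)
      in  F-encode sumT xs sum-frac })
  ∷ (computable (encode differenceT) (λ _ → tt) , λ { xs@(s ∷ t ∷ []) (_ ∷ _ ∷ []) _ →
      let difference-frac = isFrac-+ (F-isFrac s) (isFrac-neg (F-isFrac t))
      in  F-encode differenceT xs difference-frac })
  ∷ (computable (encode productT) (λ _ → tt) , λ { xs@(s ∷ t ∷ []) (_ ∷ _ ∷ []) _ →
      let product-frac = isFrac-* (F-isFrac s) (F-isFrac t)
      in  F-encode productT xs product-frac })
  ∷ (computable (encode quotientT) (λ _ → tt) , λ { xs@(s ∷ t ∷ []) (_ ∷ _ ∷ []) Ft≢0 →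
      let quotient-frac = isFrac-÷ {{≢-nonZero Ft≢0}} Ft≢0 (F-isFrac s) (F-isFrac t)
      in  F-encode quotientT xs quotient-frac })
  ∷ []

-- Translation between admissible indexings

module Evaluation {E : Set} (i : Indexing E) where

  infix 4 _names_ _⟨_⟩↦_

  _names_ : ℕ → E → Set
  x names e = Σ[ p ∈ x ∈ dom (ix i) ] at (ix i) x p ≡ e

  -- Which index is computed stays open, since an element may have several.
  _⟨_⟩↦_ : ∀ {n} → Code n → Vec ℕ n → E → Set
  c ⟨ xs ⟩↦ e = ∃[ y ] c ⟨ xs ⟩⇓ y × y names e

  nameOf : E → ℕ
  nameOf e = proj₁ (surjective i e)

  nameOf-names : ∀ e → nameOf e names e
  nameOf-names e = proj₂ (surjective i e)

  ↦const : ∀ {n} {xs : Vec ℕ n} e → constCode (nameOf e) ⟨ xs ⟩↦ e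
  ↦const e = nameOf e , ⇓const (nameOf e) , nameOf-names e

  ↦op₂ : ∀ (op : Vec E 2 ⇀ E) ((ôp , _) : ComputableRelativelyTo i (2 , op)) →
         ∀ {n} {c c′ : Code n} {xs e e′} → c ⟨ xs ⟩↦ e → c′ ⟨ xs ⟩↦ e′ →
         (d : (e ∷ e′ ∷ []) ∈ dom op) →
         comp (code ôp) (c ∷ c′ ∷ []) ⟨ xs ⟩↦ at op (e ∷ e′ ∷ []) d
  -- Matching the naming equations with `refl` turns `e` and `e′` into the values at the computed
  -- indices, so `d` has the type that `ôp-correct` expects.
  ↦op₂ op (ôp , ôp-correct) (y , ⇓y , p , refl) (y′ , ⇓y′ , p′ , refl) d =
    let z , ⇓z , z∈ = defined ôp (y ∷ y′ ∷ []) (p ∷ p′ ∷ [])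
    in  z , ⇓comp (⇓y ∷ ⇓y′ ∷ []) ⇓z , z∈ , ôp-correct (y ∷ y′ ∷ []) (p ∷ p′ ∷ []) d

module Enumeration (i : Indexing ℚ) (adm : Admissible ℚ-field i) where

  open Evaluation i public

  private
    plus : ComputableRelativelyTo i (2 , total (uncurry₂ _+_))
    plus = head adm

    minus : ComputableRelativelyTo i (2 , total (uncurry₂ _-_))
    minus = head (tail adm)

    over : ComputableRelativelyTo i (2 , division)
    over = head (tail (tail (tail adm)))

  natCode : Code 1
  natCode = prec (constCode (nameOf 0ℚ)) (comp (code (proj₁ plus)) (constCode (nameOf 1ℚ) ∷ proj 1F ∷ []))

  ↦nat : ∀ n → natCode ⟨ n ∷ [] ⟩↦ nat n
  ↦nat zero    = let y , ⇓y , named = ↦const 0ℚ in y , ⇓prec0 ⇓y , named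
  ↦nat (suc n) =
    let y , ⇓y , named = ↦nat n
        z , ⇓z , p , z≡ = ↦op₂ (total (uncurry₂ _+_)) plus (↦const 1ℚ) (y , ⇓proj {xs = n ∷ y ∷ []} 1F , named) tt
    in  z , ⇓precS ⇓y ⇓z , p , trans z≡ (sym (nat-+ 1 n))

  ↦natT : ∀ {n} (s : Total n) xs → comp natCode (program s ∷ []) ⟨ xs ⟩↦ nat (fun s xs)
  ↦natT s xs = let y , ⇓y , named = ↦nat (fun s xs) in y , ⇓comp (computes s xs ∷ []) ⇓y , named

  FCode : Code 1
  FCode = comp (code (proj₁ over))
    ( comp (code (proj₁ minus))
        ( comp natCode (program (plusPartT (var 0F)) ∷ [])
        ∷ comp natCode (program (minusPartT (var 0F)) ∷ [])
        ∷ [])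
    ∷ comp natCode (program (const 1 ⊕ denPartT (var 0F)) ∷ [])
    ∷ [])

  ↦F : ∀ t → FCode ⟨ t ∷ [] ⟩↦ F t
  ↦F t = ↦op₂ division over
    (↦op₂ (total (uncurry₂ _-_)) minus (↦natT (plusPartT (var 0F)) (t ∷ [])) (↦natT (minusPartT (var 0F)) (t ∷ [])) tt)
    (↦natT (const 1 ⊕ denPartT (var 0F)) (t ∷ []))
    -- The divisor reduces to `nat` of a successor, whose numerator cannot unify with that of `0ℚ`.
    (λ ())

  -- The bit is subtracted from 1 because `mu` looks for 0, whereas `eq` signals equality by 1.
  searchBodyCode : Code 2
  searchBodyCode = comp monusCode (comp (code (eq i)) (proj 1F ∷ comp FCode (proj 0F ∷ []) ∷ []) ∷ constCode 1 ∷ [])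

  mismatch : ∀ x → x ∈ dom (ix i) → ℕ → ℕ
  mismatch x p t = let y , _ , q , _ = ↦F t in 1 ℕ.∸ value (eq i) (x ∷ y ∷ []) (p ∷ q ∷ [])

  ⇓mismatch : ∀ x p t → searchBodyCode ⟨ t ∷ x ∷ [] ⟩⇓ mismatch x p t
  ⇓mismatch x p t =
    let y , ⇓y , q , _ = ↦F t
        b , ⇓b , _     = defined (eq i) (x ∷ y ∷ []) (p ∷ q ∷ [])
    in  ⇓comp (⇓comp (⇓proj 1F ∷ ⇓comp (⇓proj 0F ∷ []) ⇓y ∷ []) ⇓b ∷ ⇓const 1 ∷ []) (⇓monus b 1)

  F≡⇒mismatch≡0 : ∀ x p t → F t ≡ at (ix i) x p → mismatch x p t ≡ 0
  F≡⇒mismatch≡0 x p t Ft≡ = let y , _ , q , y≡ = ↦F t in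
    cong (1 ℕ.∸_) (eq-1 i x y p q (sym (trans y≡ Ft≡)))

  -- If the rationals differed, `eq-0` would make the mismatch 1. Decidable equality on ℚ removes
  -- the double negation.
  mismatch≡0⇒F≡ : ∀ x p t → mismatch x p t ≡ 0 → F t ≡ at (ix i) x p
  mismatch≡0⇒F≡ x p t mismatch≡0 = decidable-stable (F t ≟ at (ix i) x p) λ Ft≢ →
    let y , _ , q , y≡ = ↦F t
    in  ℕ.0≢1+n (trans (sym mismatch≡0)
          (cong (1 ℕ.∸_) (eq-0 i x y p q (λ x≡y → Ft≢ (sym (trans x≡y y≡))))))

  -- Surjectivity of `F` supplies a zero `w` that makes the search stop. The code found may be
  -- smaller than `w`, but has the same value under `F`.
  ⇓F-preimage : ∀ x p → ∃[ t ] mu searchBodyCode ⟨ x ∷ [] ⟩⇓ t × F t ≡ at (ix i) x p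
  ⇓F-preimage x p =
    let w , Fw≡            = F-surjective (at (ix i) x p)
        t , t-least@(≡0 , _) = least-zero (mismatch x p) {w} (F≡⇒mismatch≡0 x p w Fw≡)
    in  t , ⇓mu-least (⇓mismatch x p) t-least , mismatch≡0⇒F≡ x p t ≡0

reduces : (j j′ : Indexing ℚ) → Admissible ℚ-field j → Admissible ℚ-field j′ → ReducesTo j′ j
reduces j j′ adm adm′ = h , λ x p → let t , _ , Ft≡ = J′.⇓F-preimage x p
                                        _ , _ , _ , y≡ = J.↦F t
                                    in  sym (trans y≡ Ft≡)
  where
  module J  = Enumeration j adm
  module J′ = Enumeration j′ adm′

  h : ComputableFunction {1} (All (dom (ix j′))) (dom (ix j))
  h = record
    { code    = comp J.FCode (mu J′.searchBodyCode ∷ [])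
    ; defined = λ { (x ∷ []) (p ∷ []) →
        let t , ⇓t , _     = J′.⇓F-preimage x p
            y , ⇓y , y∈ , _ = J.↦F t
        in  y , ⇓comp (⇓t ∷ []) ⇓y , y∈ }
    }

proposition5 : ComputabilityStableOver ℚ-field
proposition5 = (F-indexing , F-admissible) , reduces
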